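{- For all integers $q \ge 3$ and $n \ge 3$, the set $\mathcal{CBFS}_q(n) = \mathcal{A}_q(n) \cup \mathcal{B}_q(n) \cup \mathcal{C}_q(n)$ is a cross-bifix-free set on $BF_q(n)$; that is, $\mathcal{CBFS}_q(n) \subseteq BF_q(n)$ and any two distinct words of $\mathcal{CBFS}_q(n)$ are cross-bifix-free.
   Context: Words. $\mathbb{Z}_q = \{0,1,\dots,q-1\}$ is an alphabet of $q$ letters and $\mathbb{Z}_q^n$ is the set of words of length $n$ over it. A word $w \in \mathbb{Z}_q^n$ is bifix-free if no non-empty proper prefix of $w$ is also a suffix of $w$. $BF_q(n)$ is the set of all bifix-free words in $\mathbb{Z}_q^n$. Two distinct words $w,w' \in BF_q(n)$ are cross-bifix-free if no non-empty strict (proper) prefix of $w$ is a suffix of $w'$ and no non-empty strict prefix of $w'$ is a suffix of $w$. A subset of $BF_q(n)$ is a cross-bifix-free set if any two distinct words in it are cross-bifix-free. Motzkin words. Words are read as lattice paths starting at $(0,0)$: the letter $0$ is a fall step $(1,-1)$, the letter $1$ is a rise step $(1,1)$, and each of the letters $2,\dots,q-1$ is a level step $(1,0)$ carrying one of $q-2$ colors (distinct letters, distinct colors). $\mathcal{M}_{q-2}(m)$ denotes the set of $(q-2)$-colored Motzkin words of length $m \ge 0$: the words in $\mathbb{Z}_q^m$ whose path ends at $(m,0)$ and never goes below the $x$-axis (for $m=0$, only the empty word). For $m \ge 2$, the set of elevated $(q-2)$-colored Motzkin words of length $m$ is $\hat{\mathcal{M}}_{q-2}(m) = \{1\alpha 0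 : \alpha \in \mathcal{M}_{q-2}(m-2)\}$. The sets. For $q\ge 3$, $n \ge 3$ (juxtaposition is concatenation): $\mathcal{A}_q(n) = \{\alpha\beta : \alpha \in \mathcal{M}_{q-2}(i),\ \beta \in \hat{\mathcal{M}}_{q-2}(n-i),\ 0 \le i \le \lfloor n/2 \rfloor\} \setminus \{\alpha\beta : \alpha,\beta \in \hat{\mathcal{M}}_{q-2}(n/2)\}$, where the removed set is taken to be empty if $n$ is odd; $\mathcal{B}_q(n) = \{1\alpha\beta : \alpha \in \mathcal{M}_{q-2}(i),\ \beta \in \hat{\mathcal{M}}_{q-2}(n-i-1),\ 0 \le i \le \lfloor n/2 \rfloor - 1\}$; $\mathcal{C}_q(n)$ is the set of words $\gamma 0$ with $\gamma \in \mathcal{M}_{q-2}(n-1)$ such that $\gamma$ cannot be written as $\gamma = u\beta v$ with $u,v$ (possibly empty) words and $\beta \in \hat{\mathcal{M}}_{q-2}(j)$ for some $j \ge \lceil n/2 \rceil$. -}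

module Defs where

open import Data.Nat.Base using (ℕ; zero; suc; _∸_; _*_; _≤_; _≥_; ⌊_/2⌋; ⌈_/2⌉; z≤n; s≤s)
open import Data.Nat.Properties using (≤-trans)
open import Data.Integer.Base as ℤ using (ℤ; 0ℤ; 1ℤ; -1ℤ)
open import Data.Fin.Base using (Fin; zero; suc; fromℕ<)
open import Data.List.Base using (List; []; _∷_; _++_; [_]; length; map; foldr)
open import Data.List.Relation.Binary.Prefix.Heterogeneous using (Prefix)
open import Data.List.Relation.Binary.Suffix.Heterogeneous using (Suffix)
open import Data.Product.Base using (_×_; ∃-syntax)
open import Level using (0ℓ)
open import Relation.Binary.PropositionalEquality using (_≡_; _≢_)
open import Relation.Nullary.Negation.Core using (¬_)
open import Relation.Unary using (Pred; _∈_; _⊆_; _∪_; _∖_)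

-- The set ℤ_q^n is represented by the words w : Word q with length w ≡ n.
Word : ℕ → Set
Word q = List (Fin q)

private
  variable
    q : ℕ

infix 4 _IsPrefixOf_ _IsSuffixOf_

_IsPrefixOf_ : Word q → Word q → Set
_IsPrefixOf_ = Prefix _≡_

_IsSuffixOf_ : Word q → Word q → Set
_IsSuffixOf_ = Suffix _≡_

-- No non-empty proper prefix of w is a suffix of w′.
NoPrefixIsSuffix : Word q → Word q → Set
NoPrefixIsSuffix w w′ =
  ∀ u → u ≢ [] → u ≢ w → u IsPrefixOf w → ¬ (u IsSuffixOf w′)

BifixFree : Word q → Set
BifixFree w = NoPrefixIsSuffix w w

BF : ℕ → Pred (Word q) 0ℓ
BF n w = length w ≡ n × BifixFree w

CrossBifixFree : Word q → Word q → Set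
CrossBifixFree w w′ = NoPrefixIsSuffix w w′ × NoPrefixIsSuffix w′ w

IsCrossBifixFreeSet : ℕ → Pred (Word q) 0ℓ → Set
IsCrossBifixFreeSet n S =
  S ⊆ BF n × (∀ w w′ → w ∈ S → w′ ∈ S → w ≢ w′ → CrossBifixFree w w′)

-- Change of height along a letter: 0 is a fall, 1 a rise, and every
-- other letter a level step (its colour being the letter itself).
step : Fin q → ℤ
step zero          = -1ℤ
step (suc zero)    = 1ℤ
step (suc (suc _)) = 0ℤ

-- Final height of the path from (0,0) coded by a word.
height : Word q → ℤ
height w = foldr ℤ._+_ 0ℤ (map step w)

-- (q-2)-coloured Motzkin words of length m.  The points of the path of w
-- are (length u , height u) for the prefixes u of w.
Motzkin : ℕ → Pred (Word q) 0ℓ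
Motzkin m w =
  length w ≡ m × height w ≡ 0ℤ × (∀ u → u IsPrefixOf w → 0ℤ ℤ.≤ height u)

module _ {q : ℕ} (q≥3 : q ≥ 3) where

  𝟘 𝟙 : Fin q
  𝟘 = fromℕ< {0} (≤-trans (s≤s z≤n) q≥3)
  𝟙 = fromℕ< {1} (≤-trans (s≤s (s≤s z≤n)) q≥3)

  -- Empty for m < 2, where the notion is undefined.
  Elevated : ℕ → Pred (Word q) 0ℓ
  Elevated m w =
    2 ≤ m × ∃[ α ] (α ∈ Motzkin (m ∸ 2) × w ≡ [ 𝟙 ] ++ α ++ [ 𝟘 ])

  -- In 𝓐, 𝓑 and 𝓒 the length n is meant to be at least 3, so that no
  -- subtraction below is truncated.

  𝓐 : ℕ → Pred (Word q) 0ℓ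
  𝓐 n = products ∖ removed
    where
    products : Pred (Word q) 0ℓ
    products w = ∃[ i ] ∃[ α ] ∃[ β ]
      ( i ≤ ⌊ n /2⌋ × α ∈ Motzkin i × β ∈ Elevated (n ∸ i)
      × w ≡ α ++ β )

    -- Here j is n/2, so this is empty when n is odd.
    removed : Pred (Word q) 0ℓ
    removed w = ∃[ j ] ∃[ α ] ∃[ β ]
      ( n ≡ 2 * j × α ∈ Elevated j × β ∈ Elevated j
      × w ≡ α ++ β )

  𝓑 : ℕ → Pred (Word q) 0ℓ
  𝓑 n w = ∃[ i ] ∃[ α ] ∃[ β ]
    ( i ≤ ⌊ n /2⌋ ∸ 1 × α ∈ Motzkin i × β ∈ Elevated (n ∸ i ∸ 1)
    × w ≡ [ 𝟙 ] ++ α ++ β )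

  𝓒 : ℕ → Pred (Word q) 0ℓ
  𝓒 n w = ∃[ γ ]
    ( γ ∈ Motzkin (n ∸ 1)
    × ¬ (∃[ u ] ∃[ β ] ∃[ v ] ∃[ j ]
           (j ≥ ⌈ n /2⌉ × β ∈ Elevated j × γ ≡ u ++ β ++ v))
    × w ≡ γ ++ [ 𝟘 ] )

  CBFS : ℕ → Pred (Word q) 0ℓ
  CBFS n = 𝓐 n ∪ 𝓑 n ∪ 𝓒 n

{-# OPTIONS --safe #-}

-- Suppose a word u is a non-empty proper prefix of w and a suffix of w′, with
-- w and w′ in CBFS.  Proper prefixes in CBFS have height ≥ 0 and proper suffixes
-- have height ≤ 0, so u has height 0.  A suffix of height 0 occurs only in 𝓐
-- and 𝓑, and it ends with the elevated factor β of length ≥ ⌈n/2⌉.  A prefix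
-- of height 0 occurs only in 𝓐 and 𝓒; in 𝓒 it contains no such factor by
-- definition, and in 𝓐 its length is at most ⌊n/2⌋, so it could only be α
-- itself, elevated of length n/2, which is excluded.

module Submission where

open import Defs
open import Data.Nat.Base as ℕ using (ℕ; suc; _∸_; _*_; _≥_; ⌊_/2⌋; ⌈_/2⌉; z≤n; s≤s)
import Data.Nat.Properties as ℕ
open import Data.Integer.Base using (0ℤ; 1ℤ; -1ℤ; +<+; -<+; _+_; _≤_; _<_)
open import Data.Integer.Properties
open import Data.List.Base using (List; []; _∷_; _++_; [_]; length)
open import Data.List.Properties using (∷-injective; ∷-injectiveʳ; length-++; ++-assoc; ++-identityʳ; ++-conicalʳ)
import Data.List.Relation.Binary.Prefix.Heterogeneous as Prefix
import Data.List.Relation.Binary.Suffix.Heterogeneous as Suffix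
open import Data.List.Relation.Binary.Pointwise using (Pointwise-≡⇒≡; ≡⇒Pointwise-≡)
open import Data.Product.Base using (_×_; _,_; ∃-syntax)
open import Data.Sum.Base using (_⊎_; inj₁; inj₂)
open import Data.Empty using (⊥; ⊥-elim)
open import Relation.Binary.PropositionalEquality
  using (_≡_; _≢_; refl; sym; trans; cong; cong₂; subst; subst₂; module ≡-Reasoning)
open import Relation.Nullary.Negation.Core using (¬_)
open import Relation.Unary using (_∈_)

module _ {a} {A : Set a} where

  -- A cut falling exactly on the border of `ys` and `zs` goes to the second case. The overhang `s`
  -- of the first is thus non-empty, which later makes a height strictly positive.
  ++-≡-++-split : (ws xs : List A) {ys zs : List A} → ws ++ xs ≡ ys ++ zs →
    (∃[ s ] (s ≢ [] × ws ≡ ys ++ s × zs ≡ s ++ xs)) ⊎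
    (∃[ s ] (ys ≡ ws ++ s × xs ≡ s ++ zs))
  ++-≡-++-split []       xs {ys}     eq = inj₂ (ys , refl , eq)
  ++-≡-++-split (w ∷ ws) xs {[]}     eq = inj₁ (w ∷ ws , (λ ()) , refl , sym eq)
  ++-≡-++-split (w ∷ ws) xs {y ∷ ys} eq
    with ∷-injective eq
  ... | refl , eq′ with ++-≡-++-split ws xs eq′
  ...   | inj₁ (s , s≢[] , p , r) = inj₁ (s , s≢[] , cong (w ∷_) p , r)
  ...   | inj₂ (s , p , r)        = inj₂ (s , cong (w ∷_) p , r)

  -- Being non-empty, `xs` must contain the final letter `z`. This confines a proper prefix of a
  -- word ending in a fall to what precedes that fall.
  ++-≡-∷ʳ-split : (ws xs : List A) {ys : List A} {z : A} → xs ≢ [] →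
    ws ++ xs ≡ ys ++ [ z ] → ∃[ s ] (ys ≡ ws ++ s × xs ≡ s ++ [ z ])
  ++-≡-∷ʳ-split ws xs xs≢[] eq with ++-≡-++-split ws xs eq
  ... | inj₂ split = split
  ... | inj₁ ([]    , s≢[] , _) = ⊥-elim (s≢[] refl)
  ... | inj₁ (_ ∷ s , _ , _ , r) = ⊥-elim (xs≢[] (++-conicalʳ s xs (sym (∷-injectiveʳ r))))

  length≤0⇒≡[] : (xs : List A) → length xs ℕ.≤ 0 → xs ≡ []
  length≤0⇒≡[] [] _ = refl

module _ {q : ℕ} where

  IsPrefixOf⇒++ : {u w : Word q} → u IsPrefixOf w → ∃[ x ] (w ≡ u ++ x)
  IsPrefixOf⇒++ u≤w with Prefix.toView u≤w
  ... | rs Prefix.++ x = x , cong (_++ x) (sym (Pointwise-≡⇒≡ rs))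

  ++-IsPrefixOf : (u x : Word q) → u IsPrefixOf (u ++ x)
  ++-IsPrefixOf u x = Prefix.fromView (≡⇒Pointwise-≡ refl Prefix.++ x)

  IsSuffixOf⇒++ : {u w : Word q} → u IsSuffixOf w → ∃[ y ] (w ≡ y ++ u)
  IsSuffixOf⇒++ u≤w with Suffix.toView u≤w
  ... | y Suffix.++ rs = y , cong (y ++_) (sym (Pointwise-≡⇒≡ rs))

  height-++ : (u v : Word q) → height (u ++ v) ≡ height u + height v
  height-++ []      v = sym (+-identityˡ (height v))
  height-++ (c ∷ u) v =
    trans (cong (step c +_) (height-++ u v)) (sym (+-assoc (step c) (height u) (height v)))

  height-split : (u : Word q) {v w : Word q} → u ++ v ≡ w → height u + height v ≡ height w
  height-split u {v} refl = sym (height-++ u v)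

  nonNegativePrefix : ∀ {m w} (u : Word q) {x} → w ∈ Motzkin m → w ≡ u ++ x → 0ℤ ≤ height u
  nonNegativePrefix u {x} (_ , _ , nonNeg) refl = nonNeg u (++-IsPrefixOf u x)

i+j≡0∧0<i⇒j<0 : ∀ {i j} → i + j ≡ 0ℤ → 0ℤ < i → j < 0ℤ
i+j≡0∧0<i⇒j<0 {j = j} eq 0<i = subst₂ _<_ (+-identityˡ j) eq (+-monoˡ-< j 0<i)

i+j≡k∧0≤i⇒j≤k : ∀ {i j k} → i + j ≡ k → 0ℤ ≤ i → j ≤ k
i+j≡k∧0≤i⇒j≤k {j = j} eq 0≤i = subst₂ _≤_ (+-identityˡ j) eq (+-monoˡ-≤ j 0≤i)

n∸⌊n/2⌋≡⌈n/2⌉ : ∀ n → n ∸ ⌊ n /2⌋ ≡ ⌈ n /2⌉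
n∸⌊n/2⌋≡⌈n/2⌉ n = trans (cong (_∸ ⌊ n /2⌋) (sym (ℕ.⌊n/2⌋+⌈n/2⌉≡n n))) (ℕ.m+n∸m≡n ⌊ n /2⌋ ⌈ n /2⌉)

i≤⌊n/2⌋⇒⌈n/2⌉≤n∸i : ∀ n {i} → i ℕ.≤ ⌊ n /2⌋ → ⌈ n /2⌉ ℕ.≤ n ∸ i
i≤⌊n/2⌋⇒⌈n/2⌉≤n∸i n {i} i≤ = subst (ℕ._≤ n ∸ i) (n∸⌊n/2⌋≡⌈n/2⌉ n) (ℕ.∸-monoʳ-≤ n i≤)

i≤⌊n/2⌋∸1⇒⌈n/2⌉≤n∸i∸1 : ∀ n {i} → n ≥ 3 → i ℕ.≤ ⌊ n /2⌋ ∸ 1 → ⌈ n /2⌉ ℕ.≤ n ∸ i ∸ 1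
-- Matching on `n ≥ 3` exposes `⌊ n /2⌋` as a successor, so its `∸ 1` is not truncated and the
-- previous bound applies to `suc i`.
i≤⌊n/2⌋∸1⇒⌈n/2⌉≤n∸i∸1 n {i} (s≤s (s≤s (s≤s _))) i≤ =
  subst (⌈ n /2⌉ ℕ.≤_) (trans (cong (n ∸_) (ℕ.+-comm 1 i)) (sym (ℕ.∸-+-assoc n i 1)))
    (i≤⌊n/2⌋⇒⌈n/2⌉≤n∸i n (s≤s i≤))

-- The letters come from `fromℕ<`, so `step` computes on them only once matching on `q≥3` has
-- exposed the successors in `q`.
step-𝟘 : ∀ {q} (q≥3 : q ≥ 3) → step (𝟘 q≥3) ≡ -1ℤ
step-𝟘 (s≤s _) = refl

step-𝟙 : ∀ {q} (q≥3 : q ≥ 3) → step (𝟙 q≥3) ≡ 1ℤ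
step-𝟙 (s≤s (s≤s _)) = refl

module _ {q : ℕ} (q≥3 : q ≥ 3) where

  height-∷-𝟙 : ∀ u → height (𝟙 q≥3 ∷ u) ≡ 1ℤ + height u
  height-∷-𝟙 u = cong (_+ height u) (step-𝟙 q≥3)

  0<height-∷-𝟙 : ∀ {u} → 0ℤ ≤ height u → 0ℤ < height (𝟙 q≥3 ∷ u)
  0<height-∷-𝟙 {u} 0≤u = subst (0ℤ <_) (sym (height-∷-𝟙 u)) (+-mono-<-≤ (+<+ (s≤s z≤n)) 0≤u)

  height-[𝟘] : height [ 𝟘 q≥3 ] ≡ -1ℤ
  height-[𝟘] = trans (+-identityʳ _) (step-𝟘 q≥3)

  length-Elevated : ∀ {m β} → β ∈ Elevated q≥3 m → length β ≡ m
  length-Elevated (s≤s (s≤s z≤n) , α , (refl , _) , refl) =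
    cong suc (trans (length-++ α) (ℕ.+-comm (length α) 1))

  height-Elevated : ∀ {m β} → β ∈ Elevated q≥3 m → height β ≡ 0ℤ
  height-Elevated (_ , α , (_ , hα , _) , refl) = begin
    height (𝟙 q≥3 ∷ α ++ [ 𝟘 q≥3 ])     ≡⟨ height-∷-𝟙 (α ++ [ 𝟘 q≥3 ]) ⟩
    1ℤ + height (α ++ [ 𝟘 q≥3 ])        ≡⟨ cong (1ℤ +_) (height-++ α [ 𝟘 q≥3 ]) ⟩
    1ℤ + (height α + height [ 𝟘 q≥3 ])  ≡⟨ cong (1ℤ +_) (cong₂ _+_ hα height-[𝟘]) ⟩
    0ℤ                                  ∎
    where open ≡-Reasoning

  -- The prefix takes the initial rise but not the final fall, which lies in `x`; in between it
  -- follows a Motzkin path.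
  Elevated-prefix-positive : ∀ {m β} s x → β ∈ Elevated q≥3 m → β ≡ s ++ x →
    s ≢ [] → x ≢ [] → 0ℤ < height s
  Elevated-prefix-positive []      x _ _ s≢[] _ = ⊥-elim (s≢[] refl)
  Elevated-prefix-positive (c ∷ s) x (_ , α , α∈M , refl) eq _ x≢[]
    with refl , eq′ ← ∷-injective eq
    with t , α≡s++t , _ ← ++-≡-∷ʳ-split s x x≢[] (sym eq′) =
    0<height-∷-𝟙 {s} (nonNegativePrefix s α∈M α≡s++t)

  -- A cut strictly inside `β` gives `u` the height of a non-empty proper prefix of `β`, since `α`
  -- returns to 0. Any other cut lies in `α`, possibly at its end.
  Motzkin-Elevated-split : ∀ {i m α β} u x → α ∈ Motzkin i → β ∈ Elevated q≥3 m →
    u ++ x ≡ α ++ β → x ≢ [] →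
    0ℤ < height u ⊎ (∃[ s ] (α ≡ u ++ s × x ≡ s ++ β))
  Motzkin-Elevated-split {α = α} u x (_ , hα , _) β∈E eq x≢[]
    with ++-≡-++-split u x eq
  ... | inj₂ split = inj₂ split
  ... | inj₁ (s , s≢[] , refl , β≡s++x) = inj₁ (subst (0ℤ <_) (sym hu)
          (Elevated-prefix-positive s x β∈E β≡s++x s≢[] x≢[]))
    where
    hu : height (α ++ s) ≡ height s
    hu = trans (height-++ α s) (trans (cong (_+ height s) hα) (+-identityˡ (height s)))

  Motzkin-Elevated-nonNegative : ∀ {i m α β} u x → α ∈ Motzkin i → β ∈ Elevated q≥3 m →
    u ++ x ≡ α ++ β → x ≢ [] → 0ℤ ≤ height u
  Motzkin-Elevated-nonNegative u x α∈M β∈E eq x≢[]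
    with Motzkin-Elevated-split u x α∈M β∈E eq x≢[]
  ... | inj₁ 0<u          = <⇒≤ 0<u
  ... | inj₂ (s , α≡ , _) = nonNegativePrefix u α∈M α≡

  -- This property tells apart suffixes and prefixes of height 0. The bound on `j` and the arbitrary
  -- `s` match the factors forbidden in `𝓒`.
  EndsElevated : ℕ → Word q → Set
  EndsElevated n u = ∃[ s ] ∃[ β ] ∃[ j ] (j ≥ ⌈ n /2⌉ × β ∈ Elevated q≥3 j × u ≡ s ++ β)

  -- Since `αβ` ends at height 0, `y` and `u` have opposite heights. A cut inside `β` makes `y`
  -- strictly positive; any other leaves `β` whole at the end of `u`.
  Motzkin-Elevated-suffix : ∀ {n i m α β} y u → α ∈ Motzkin i → β ∈ Elevated q≥3 m →
    m ≥ ⌈ n /2⌉ → y ++ u ≡ α ++ β → u ≢ [] →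
    height u < 0ℤ ⊎ (height u ≤ 0ℤ × EndsElevated n u)
  Motzkin-Elevated-suffix {α = α} {β} y u α∈M@(_ , hα , _) β∈E m≥ eq u≢[]
    with hyu ← trans (height-split y eq) (trans (height-++ α β) (cong₂ _+_ hα (height-Elevated β∈E)))
    with Motzkin-Elevated-split y u α∈M β∈E eq u≢[]
  ... | inj₁ 0<y = inj₁ (i+j≡0∧0<i⇒j<0 hyu 0<y)
  ... | inj₂ (s , α≡ , u≡) =
    inj₂ (i+j≡k∧0≤i⇒j≤k hyu (nonNegativePrefix y α∈M α≡) , s , β , _ , m≥ , β∈E , u≡)

  CBFS-suffix : ∀ {n w} y u → n ≥ 3 → w ∈ CBFS q≥3 n → w ≡ y ++ u → y ≢ [] → u ≢ [] →
    height u < 0ℤ ⊎ (height u ≤ 0ℤ × EndsElevated n u)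
  CBFS-suffix {n} y u n≥3 (inj₁ ((i , α , β , i≤ , α∈M , β∈E , refl) , _)) eq _ u≢[] =
    Motzkin-Elevated-suffix y u α∈M β∈E (i≤⌊n/2⌋⇒⌈n/2⌉≤n∸i n i≤) (sym eq) u≢[]
  CBFS-suffix [] u _ (inj₂ (inj₁ _)) _ y≢[] _ = ⊥-elim (y≢[] refl)
  -- A proper suffix misses the leading rise, so it is a suffix of `αβ`, possibly all of it.
  CBFS-suffix {n} (c ∷ y) u n≥3 (inj₂ (inj₁ (i , α , β , i≤ , α∈M , β∈E , refl))) eq _ u≢[] =
    Motzkin-Elevated-suffix y u α∈M β∈E (i≤⌊n/2⌋∸1⇒⌈n/2⌉≤n∸i∸1 n n≥3 i≤)
      (sym (∷-injectiveʳ eq)) u≢[]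
  -- The whole word has height -1, while `y` lies inside `γ` and so has height at least 0.
  CBFS-suffix y u n≥3 (inj₂ (inj₂ (γ , γ∈M@(_ , hγ , _) , _ , refl))) eq _ u≢[]
    with t , γ≡ , _ ← ++-≡-∷ʳ-split y u u≢[] (sym eq) =
    inj₁ (≤-<-trans (i+j≡k∧0≤i⇒j≤k hyu (nonNegativePrefix y γ∈M γ≡)) -<+)
    where
    hyu : height y + height u ≡ -1ℤ
    hyu = trans (height-split y (sym eq)) (trans (height-++ γ [ 𝟘 q≥3 ]) (cong₂ _+_ hγ height-[𝟘]))

  -- The chain ⌈n/2⌉ ≤ j ≤ i ≤ ⌊n/2⌋ ≤ ⌈n/2⌉ collapses to equalities, j being the length of the
  -- elevated factor. That factor then fills `u ++ s`, which in `CBFS-prefix` is the `α` of a word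
  -- in `𝓐`.
  elevated-of-half-length : ∀ {n} u s {i} → i ℕ.≤ ⌊ n /2⌋ → length (u ++ s) ≡ i →
    EndsElevated n u → n ≡ 2 * i × n ∸ i ≡ i × u ++ s ∈ Elevated q≥3 i
  elevated-of-half-length {n} u s {i} i≤ refl (t , β , j , j≥ , β∈E , refl) =
    n≡2i , trans (cong (_∸ i) n≡i+i) (ℕ.m+n∸m≡n i i) ,
    subst₂ (λ k w → w ∈ Elevated q≥3 k) j≡i β≡ β∈E
    where
    len : length t ℕ.+ j ℕ.+ length s ≡ i
    len = sym (trans (length-++ (t ++ β)) (cong (ℕ._+ length s)
            (trans (length-++ t) (cong (length t ℕ.+_) (length-Elevated β∈E)))))

    i≤j : i ℕ.≤ j
    i≤j = ℕ.≤-trans i≤ (ℕ.≤-trans (ℕ.⌊n/2⌋≤⌈n/2⌉ n) j≥)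

    t+j≤i : length t ℕ.+ j ℕ.≤ i
    t+j≤i = subst (length t ℕ.+ j ℕ.≤_) len (ℕ.m≤m+n _ _)

    j≤i : j ℕ.≤ i
    j≤i = ℕ.≤-trans (ℕ.m≤n+m j (length t)) t+j≤i

    j≡i : j ≡ i
    j≡i = ℕ.≤-antisym j≤i i≤j

    t≡[] : t ≡ []
    t≡[] = length≤0⇒≡[] t (ℕ.+-cancelʳ-≤ j _ 0 (ℕ.≤-trans t+j≤i i≤j))

    s≡[] : s ≡ []
    s≡[] = length≤0⇒≡[] s (ℕ.+-cancelˡ-≤ j _ 0 (subst (j ℕ.+ length s ℕ.≤_) (sym (ℕ.+-identityʳ j))
             (ℕ.≤-trans (ℕ.+-monoˡ-≤ (length s) (ℕ.m≤n+m j (length t)))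
               (ℕ.≤-trans (ℕ.≤-reflexive len) i≤j))))

    β≡ : β ≡ (t ++ β) ++ s
    β≡ = sym (trans (cong₂ (λ t s → (t ++ β) ++ s) t≡[] s≡[]) (++-identityʳ β))

    i≡⌊n/2⌋ : i ≡ ⌊ n /2⌋
    i≡⌊n/2⌋ = ℕ.≤-antisym i≤ (ℕ.≤-trans (ℕ.⌊n/2⌋≤⌈n/2⌉ n) (ℕ.≤-trans j≥ j≤i))

    i≡⌈n/2⌉ : i ≡ ⌈ n /2⌉
    i≡⌈n/2⌉ = ℕ.≤-antisym (ℕ.≤-trans i≤ (ℕ.⌊n/2⌋≤⌈n/2⌉ n)) (ℕ.≤-trans j≥ j≤i)

    n≡i+i : n ≡ i ℕ.+ i
    n≡i+i = trans (sym (ℕ.⌊n/2⌋+⌈n/2⌉≡n n)) (sym (cong₂ ℕ._+_ i≡⌊n/2⌋ i≡⌈n/2⌉))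

    n≡2i : n ≡ 2 * i
    n≡2i = trans n≡i+i (cong (i ℕ.+_) (sym (ℕ.+-identityʳ i)))

  CBFS-prefix : ∀ {n w} u x → w ∈ CBFS q≥3 n → w ≡ u ++ x → u ≢ [] → x ≢ [] →
    0ℤ < height u ⊎ (0ℤ ≤ height u × ¬ EndsElevated n u)
  CBFS-prefix {n} u x (inj₁ ((i , α , β , i≤ , α∈M@(lα , _) , β∈E , refl) , notRemoved)) eq _ x≢[]
    with Motzkin-Elevated-split u x α∈M β∈E (sym eq) x≢[]
  ... | inj₁ 0<u = inj₁ 0<u
  -- If `u` ended with a long elevated word, `α` and `β` would both be elevated of length n/2, and
  -- the word would have been removed from `𝓐`.
  ... | inj₂ (s , refl , _) = inj₂ (nonNegativePrefix u α∈M refl , λ ends →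
    let n≡2i , n∸i≡i , α∈E = elevated-of-half-length u s i≤ lα ends
    in notRemoved (i , α , β , n≡2i , α∈E , subst (λ m → β ∈ Elevated q≥3 m) n∸i≡i β∈E , refl))
  CBFS-prefix [] x (inj₂ (inj₁ _)) _ u≢[] _ = ⊥-elim (u≢[] refl)
  -- The leading rise lifts a prefix of `αβ` of height at least 0, so height 0 never occurs in `𝓑`.
  CBFS-prefix (c ∷ u) x (inj₂ (inj₁ (i , α , β , _ , α∈M , β∈E , refl))) eq _ x≢[]
    with refl , eq′ ← ∷-injective eq =
    inj₁ (0<height-∷-𝟙 {u} (Motzkin-Elevated-nonNegative u x α∈M β∈E (sym eq′) x≢[]))
  -- As `u` lies inside `γ`, a long elevated word ending `u` would be a forbidden factor of `γ`.
  CBFS-prefix u x (inj₂ (inj₂ (γ , γ∈M , noLongElevated , refl))) eq _ x≢[]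
    with t , γ≡ , _ ← ++-≡-∷ʳ-split u x x≢[] (sym eq) =
    inj₂ (nonNegativePrefix u γ∈M γ≡ , λ { (s , β , j , j≥ , β∈E , refl) →
      noLongElevated (s , β , t , j , j≥ , β∈E , trans γ≡ (++-assoc s β t)) })

  CBFS-length : ∀ {n w} → n ≥ 3 → w ∈ CBFS q≥3 n → length w ≡ n
  CBFS-length {n} _ (inj₁ ((i , α , β , i≤ , (lα , _) , β∈E , refl) , _)) =
    trans (length-++ α) (trans (cong₂ ℕ._+_ lα (length-Elevated β∈E))
      (ℕ.m+[n∸m]≡n (ℕ.≤-trans i≤ (ℕ.⌊n/2⌋≤n n))))
  CBFS-length {n} _ (inj₂ (inj₁ (i , α , β , _ , (lα , _) , β∈E@(2≤n∸i∸1 , _) , refl))) =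
    trans (cong suc (trans (length-++ α) (cong₂ ℕ._+_ lα (trans (length-Elevated β∈E) n∸i∸1≡))))
      (ℕ.m+[n∸m]≡n i<n)
    where
    n∸i∸1≡ : n ∸ i ∸ 1 ≡ n ∸ suc i
    n∸i∸1≡ = trans (ℕ.∸-+-assoc n i 1) (cong (n ∸_) (ℕ.+-comm i 1))

    i<n : i ℕ.< n
    -- If `n ∸ i` were 0, the elevated word `β` would have length 0 instead of at least 2.
    i<n = ℕ.m∸n≢0⇒n<m λ n∸i≡0 → ℕ.<⇒≱ (s≤s z≤n) (subst (λ k → 2 ℕ.≤ k ∸ 1) n∸i≡0 2≤n∸i∸1)
  CBFS-length (s≤s _) (inj₂ (inj₂ (γ , (lγ , _) , _ , refl))) =
    trans (length-++ γ) (trans (ℕ.+-comm (length γ) 1) (cong suc lγ))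

  -- Since `w` and `w′` may coincide, this covers bifix-freeness as well as both halves of
  -- cross-bifix-freeness.
  CBFS-noPrefixIsSuffix : ∀ {n w w′} → n ≥ 3 → w ∈ CBFS q≥3 n → w′ ∈ CBFS q≥3 n →
    NoPrefixIsSuffix w w′
  CBFS-noPrefixIsSuffix {n} n≥3 w∈ w′∈ u u≢[] u≢w u≤w u≤w′
    with x , refl ← IsPrefixOf⇒++ u≤w | y , refl ← IsSuffixOf⇒++ u≤w′ = contra
    where
    -- Equal lengths carry over properness: `u` is proper as a suffix of `w′` because it is proper
    -- as a prefix of `w`.
    sameLength : length x ≡ length y
    sameLength = ℕ.+-cancelˡ-≡ (length u) _ _ (begin
      length u ℕ.+ length x  ≡⟨ length-++ u ⟨
      length (u ++ x)        ≡⟨ CBFS-length n≥3 w∈ ⟩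
      n                      ≡⟨ CBFS-length n≥3 w′∈ ⟨
      length (y ++ u)        ≡⟨ length-++ y ⟩
      length y ℕ.+ length u  ≡⟨ ℕ.+-comm (length y) (length u) ⟩
      length u ℕ.+ length y  ∎)
      where open ≡-Reasoning

    x≢[] : x ≢ []
    x≢[] refl = u≢w (sym (++-identityʳ u))

    y≢[] : y ≢ []
    y≢[] refl = x≢[] (length≤0⇒≡[] x (ℕ.≤-reflexive sameLength))

    contra : ⊥
    contra with CBFS-prefix u x w∈ refl u≢[] x≢[] | CBFS-suffix y u n≥3 w′∈ refl y≢[] u≢[]
    ... | inj₁ 0<u         | inj₁ u<0         = <-asym 0<u u<0
    ... | inj₁ 0<u         | inj₂ (u≤0 , _)   = <⇒≱ 0<u u≤0
    ... | inj₂ (0≤u , _)   | inj₁ u<0         = <⇒≱ u<0 0≤u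
    -- Only in this case do the signs allow height 0, and `EndsElevated` decides.
    ... | inj₂ (_ , ¬ends) | inj₂ (_ , ends)  = ¬ends ends

proposition3p1 : (q n : ℕ) (q≥3 : q ≥ 3) → n ≥ 3 → IsCrossBifixFreeSet n (CBFS q≥3 n)
proposition3p1 q n q≥3 n≥3 =
  (λ w∈ → CBFS-length q≥3 n≥3 w∈ , CBFS-noPrefixIsSuffix q≥3 n≥3 w∈ w∈) ,
  (λ w w′ w∈ w′∈ _ →
    CBFS-noPrefixIsSuffix q≥3 n≥3 w∈ w′∈ , CBFS-noPrefixIsSuffix q≥3 n≥3 w′∈ w∈)
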